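{- Suppose $|A|>1$. Then there exists a Hoare-McCarthy algebra $\mathbb{A}^{mem}$ (over the atom set $A$) such that for all closed terms $t,t'\in\mathcal{T}_{\Sigma^A_{ce}}$, $$\mathrm{CP}_{mem}\vdash t=t'\iff \mathbb{A}^{mem}\models t=t'.$$
   Context: Let $A$ be a non-empty, denumerable (finite or countably infinite) set of atoms. $\Sigma^A_{ce}$ is the one-sorted signature with sort $C$ (conditional expressions), constants $T$, $F$ and $a$ (one for each $a\in A$), and a ternary operation $x\triangleleft y\triangleright z$ ("if $y$ then $x$ else $z$"). $\mathcal{T}_{\Sigma^A_{ce}}$ is the set of closed (variable-free) terms over $\Sigma^A_{ce}$. $\mathrm{CP}$ is the set of the four equations (CP1) $x\triangleleft T\triangleright y=x$; (CP2) $x\triangleleft F\triangleright y=y$; (CP3) $T\triangleleft x\triangleright F=x$; (CP4) $x\triangleleft(y\triangleleft z\triangleright u)\triangleright v=(x\triangleleft y\triangleright v)\triangleleft z\triangleright(x\triangleleft u\triangleright v)$. $\mathrm{CP}_{mem}$ is $\mathrm{CP}$ together with the equation (CPmem) $x\triangleleft y\triangleright(z\triangleleft u\triangleright(v\triangleleft y\triangleright w))=x\triangleleft y\triangleright(z\triangleleft u\triangleright w)$. $E\vdash t=t'$ means derivability in equational logic from the set $E$ of equations. A stateful proposition algebra (SPA) is a two-sorted algebra with sorts $C$ and $S$ (states), with the operations of $\Sigma^A_{ce}$ on sort $C$, a constant $c$ of sort $S$, and operations $\cdot\triangleleft\cdot\triangleright\cdot:S\times C\times S\to S$, $\bullet:C\times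 S\to S$ (apply), $!:C\times S\to C$ (reply), satisfying CP on sort $C$ and, for all $x,y,z$ in $C$ and $s,s'$ in $S$ ($\bullet$ and $!$ bind stronger than the conditional): (TS1) $s\triangleleft T\triangleright s'=s$; (TS2) $s\triangleleft F\triangleright s'=s'$; (TS3) if $x\neq T$ and $x\neq F$ then $s\triangleleft x\triangleright s'=c$; (SPA1) $T!s=T$; (SPA2) $F!s=F$; (SPA3) $(x\triangleleft y\triangleright z)!s=x!(y\bullet s)\triangleleft y!s\triangleright z!(y\bullet s)$; (SPA4) $T\bullet s=s$; (SPA5) $F\bullet s=s$; (SPA6) $(x\triangleleft y\triangleright z)\bullet s=x\bullet(y\bullet s)\triangleleft y!s\triangleright z\bullet(y\bullet s)$; (SPA7) $x!s=T$ or $x!s=F$; (SPA8) if $x!s=y!s$ and $x\bullet s=y\bullet s$ for all $s$ in $S$, then $x=y$. A Hoare-McCarthy algebra (HMA) is the $\Sigma^A_{ce}$-reduct of a stateful proposition algebra (i.e. sort $C$ with the operations of $\Sigma^A_{ce}$). -}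

module Defs where

open import Level using (0ℓ)
open import Data.Empty using (⊥)
open import Data.Fin using (Fin)
open import Data.Nat using (ℕ)
open import Data.Product using (∃; ∃-syntax; ∃₂)
open import Data.Sum using (_⊎_)
open import Function.Bundles using (_↔_)
open import Relation.Binary using (Rel; Setoid; IsEquivalence)
open import Relation.Binary.PropositionalEquality using (_≡_; _≢_)
open import Relation.Nullary using (¬_)

Denumerable : Set → Set
Denumerable A = (∃[ n ] (Fin n ↔ A)) ⊎ (ℕ ↔ A)

∣_∣>1 : Set → Set
∣ A ∣>1 = ∃₂ λ (a b : A) → a ≢ b

-- The term constructors share their names with the operations of an
-- algebra, hence the separate module.
module Syntax where

  infix 6 _◁_▷_
  infix 4 _⊢_≈_

  -- x ◁ y ▷ z is "if y then x else z".
  data Term (A V : Set) : Set where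
    var   : V → Term A V
    T F   : Term A V
    atom  : A → Term A V
    _◁_▷_ : Term A V → Term A V → Term A V → Term A V

  OpenTerm ClosedTerm : Set → Set
  OpenTerm   A = Term A ℕ
  ClosedTerm A = Term A ⊥

  _[_] : ∀ {A V W} → Term A V → (V → Term A W) → Term A W
  var v       [ σ ] = σ v
  T           [ σ ] = T
  F           [ σ ] = F
  atom a      [ σ ] = atom a
  (t ◁ u ▷ v) [ σ ] = (t [ σ ]) ◁ (u [ σ ]) ▷ (v [ σ ])

  ι : ∀ {A} → ClosedTerm A → OpenTerm A
  ι t = t [ (λ ()) ]

  Equations : Set → Set₁
  Equations A = Rel (OpenTerm A) 0ℓ

  data _⊢_≈_ {A : Set} (E : Equations A) : OpenTerm A → OpenTerm A → Set where
    axiom : ∀ {t t′} → E t t′ → E ⊢ t ≈ t′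
    refl  : ∀ {t} → E ⊢ t ≈ t
    sym   : ∀ {t t′} → E ⊢ t ≈ t′ → E ⊢ t′ ≈ t
    trans : ∀ {t t′ t″} → E ⊢ t ≈ t′ → E ⊢ t′ ≈ t″ → E ⊢ t ≈ t″
    cong  : ∀ {t t′ u u′ v v′} → E ⊢ t ≈ t′ → E ⊢ u ≈ u′ → E ⊢ v ≈ v′ →
            E ⊢ t ◁ u ▷ v ≈ t′ ◁ u′ ▷ v′
    inst  : ∀ {t t′} (σ : ℕ → OpenTerm A) → E ⊢ t ≈ t′ →
            E ⊢ t [ σ ] ≈ t′ [ σ ]

  private
    module Variables {A : Set} where
      x y z u v w : OpenTerm A
      x = var 0
      y = var 1
      z = var 2
      u = var 3
      v = var 4
      w = var 5
    open Variables

  data CP {A : Set} : Equations A where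
    CP1 : CP (x ◁ T ▷ y) x
    CP2 : CP (x ◁ F ▷ y) y
    CP3 : CP (T ◁ x ▷ F) x
    CP4 : CP (x ◁ (y ◁ z ▷ u) ▷ v) ((x ◁ y ▷ v) ◁ z ▷ (x ◁ u ▷ v))

  data CPmem {A : Set} : Equations A where
    cp  : ∀ {t t′} → CP t t′ → CPmem t t′
    mem : CPmem (x ◁ y ▷ (z ◁ u ▷ (v ◁ y ▷ w))) (x ◁ y ▷ (z ◁ u ▷ w))

open Syntax public
  using (Term; var; OpenTerm; ClosedTerm; _[_]; ι; Equations; _⊢_≈_; CP; CPmem)

-- Σ^A_ce-algebras; as usual for algebras in Agda, the carrier is a setoid
-- and ≈ plays the role of equality.
record CEAlgebra (A : Set) : Set₁ where
  infix 6 _◁_▷_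
  infix 4 _≈_
  field
    Carrier       : Set
    _≈_           : Rel Carrier 0ℓ
    isEquivalence : IsEquivalence _≈_
    T F           : Carrier
    atom          : A → Carrier
    _◁_▷_         : Carrier → Carrier → Carrier → Carrier
    ◁▷-cong       : ∀ {x x′ y y′ z z′} → x ≈ x′ → y ≈ y′ → z ≈ z′ →
                    x ◁ y ▷ z ≈ x′ ◁ y′ ▷ z′

module _ {A : Set} (𝔸 : CEAlgebra A) where
  private module 𝔸 = CEAlgebra 𝔸

  eval : ∀ {V} → (V → 𝔸.Carrier) → Term A V → 𝔸.Carrier
  eval ρ (var v)            = ρ v
  eval ρ Syntax.T           = 𝔸.T
  eval ρ Syntax.F           = 𝔸.F
  eval ρ (Syntax.atom a)    = 𝔸.atom a
  eval ρ (t Syntax.◁ u ▷ v) = eval ρ t 𝔸.◁ eval ρ u ▷ eval ρ v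

  infix 4 _⊨_≈_ _⊨_

  _⊨_≈_ : OpenTerm A → OpenTerm A → Set
  _⊨_≈_ t t′ = ∀ ρ → eval ρ t 𝔸.≈ eval ρ t′

  _⊨_ : Equations A → Set
  _⊨_ E = ∀ {t t′} → E t t′ → _⊨_≈_ t t′

record StatefulPropositionAlgebra (A : Set) : Set₁ where
  infix 6 _◁ˢ_▷_
  infixr 7 _•_
  infix 7 _!_
  infix 4 _≈ˢ_
  field
    reduct : CEAlgebra A

  open CEAlgebra reduct public renaming (Carrier to C)

  field
    S              : Set
    _≈ˢ_           : Rel S 0ℓ
    isEquivalenceˢ : IsEquivalence _≈ˢ_
    c              : S
    _◁ˢ_▷_         : S → C → S → S
    _•_            : C → S → S
    _!_            : C → S → C

    ◁ˢ▷-cong : ∀ {s₁ s₂ x y s₁′ s₂′} → s₁ ≈ˢ s₂ → x ≈ y → s₁′ ≈ˢ s₂′ →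
               s₁ ◁ˢ x ▷ s₁′ ≈ˢ s₂ ◁ˢ y ▷ s₂′
    •-cong   : ∀ {x y s s′} → x ≈ y → s ≈ˢ s′ → x • s ≈ˢ y • s′
    !-cong   : ∀ {x y s s′} → x ≈ y → s ≈ˢ s′ → x ! s ≈ y ! s′

    cp   : reduct ⊨ CP
    TS1  : ∀ s s′ → s ◁ˢ T ▷ s′ ≈ˢ s
    TS2  : ∀ s s′ → s ◁ˢ F ▷ s′ ≈ˢ s′
    TS3  : ∀ x s s′ → ¬ x ≈ T → ¬ x ≈ F → s ◁ˢ x ▷ s′ ≈ˢ c
    SPA1 : ∀ s → T ! s ≈ T
    SPA2 : ∀ s → F ! s ≈ F
    SPA3 : ∀ x y z s →
           (x ◁ y ▷ z) ! s ≈ (x ! (y • s)) ◁ (y ! s) ▷ (z ! (y • s))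
    SPA4 : ∀ s → T • s ≈ˢ s
    SPA5 : ∀ s → F • s ≈ˢ s
    SPA6 : ∀ x y z s →
           (x ◁ y ▷ z) • s ≈ˢ (x • (y • s)) ◁ˢ (y ! s) ▷ (z • (y • s))
    SPA7 : ∀ x s → x ! s ≈ T ⊎ x ! s ≈ F
    SPA8 : ∀ x y → (∀ s → x ! s ≈ y ! s) → (∀ s → x • s ≈ˢ y • s) → x ≈ y

IsHoareMcCarthyAlgebra : ∀ {A} → CEAlgebra A → Set₁
IsHoareMcCarthyAlgebra {A} 𝔸 = ∃ λ (P : StatefulPropositionAlgebra A) → P .reduct ≡ 𝔸
  where open StatefulPropositionAlgebra

{-# OPTIONS --safe #-}

-- A state consists of the atoms evaluated so far, with their replies, and an
-- infinite oracle. A remembered atom is answered from memory; a fresh one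
-- takes the next bit of the oracle and is recorded. Two closed terms are
-- identified when they give the same reply and the same final state from
-- every state.
--
-- For completeness, every term is provably equal to a decision tree in which
-- no path queries an atom twice. The oracle can steer the evaluation down any
-- path of such a tree, and the final history spells out that path, so
-- identified terms have the same tree.
module Submission where

open import Data.Bool using (Bool; true; false; if_then_else_)
open import Data.Fin.Properties using () renaming (_≟_ to _≟ᶠ_)
open import Data.List using (List; []; _∷_; _++_; _∷ʳ_)
open import Data.List.Properties using (++-cancelʳ; ∷ʳ-injectiveʳ; ∷ʳ-++)
open import Data.Maybe using (Maybe; just; nothing)
open import Data.Nat using (ℕ; zero; suc)
open import Data.Nat.Properties using () renaming (_≟_ to _≟ⁿ_)
open import Data.Product using (Σ-syntax; ∃-syntax; _×_; _,_; proj₁; proj₂)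
open import Data.Sum using (_⊎_; inj₁; inj₂)
open import Function using (_∘_; _$_)
open import Function.Bundles using (_⇔_; mk⇔)
open import Function.Properties.Inverse using (↔-sym; ↔⇒↣)
open import Relation.Binary using (DecidableEquality; Setoid)
open import Relation.Binary.PropositionalEquality
  using (_≡_; _≢_; refl; sym; trans; cong; cong₂; subst; subst₂; isEquivalence)
open import Relation.Nullary using (¬_; yes; no; contradiction)
open import Relation.Nullary.Decidable using (via-injection)
import Relation.Binary.Reasoning.Setoid as SetoidReasoning
open import Defs
open Syntax using (T; F; atom; _◁_▷_)

-- Looking up an atom in a history requires comparing atoms; the enumeration transports the test
-- from `Fin n` or `ℕ`.
denumerable⇒≟ : ∀ {A} → Denumerable A → DecidableEquality A
denumerable⇒≟ (inj₁ (_ , Fin↔A)) = via-injection (↔⇒↣ (↔-sym Fin↔A)) _≟ᶠ_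
denumerable⇒≟ (inj₂ ℕ↔A)         = via-injection (↔⇒↣ (↔-sym ℕ↔A)) _≟ⁿ_

-- Soundness of equational derivations

module _ {A : Set} (𝔸 : CEAlgebra A) where
  open CEAlgebra 𝔸 using (_≈_; ◁▷-cong) renaming (isEquivalence to ≈-isEquivalence)

  private
    setoid : Setoid _ _
    setoid = record { isEquivalence = ≈-isEquivalence }
    module ≈ = Setoid setoid

  eval-[] : ∀ {V W} (ρ : W → CEAlgebra.Carrier 𝔸) (σ : V → Term A W) t →
            eval 𝔸 ρ (t [ σ ]) ≈ eval 𝔸 (eval 𝔸 ρ ∘ σ) t
  eval-[] ρ σ (var v)     = ≈.refl
  eval-[] ρ σ T           = ≈.refl
  eval-[] ρ σ F           = ≈.refl
  eval-[] ρ σ (atom a)    = ≈.refl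
  eval-[] ρ σ (t ◁ u ▷ v) = ◁▷-cong (eval-[] ρ σ t) (eval-[] ρ σ u) (eval-[] ρ σ v)

  ⊢-sound : ∀ {E} → _⊨_ 𝔸 E → ∀ {t t′} → E ⊢ t ≈ t′ → _⊨_≈_ 𝔸 t t′
  ⊢-sound ⊨E (Syntax.axiom e)       ρ = ⊨E e ρ
  ⊢-sound ⊨E Syntax.refl            ρ = ≈.refl
  ⊢-sound ⊨E (Syntax.sym d)         ρ = ≈.sym (⊢-sound ⊨E d ρ)
  ⊢-sound ⊨E (Syntax.trans d e)     ρ = ≈.trans (⊢-sound ⊨E d ρ) (⊢-sound ⊨E e ρ)
  ⊢-sound ⊨E (Syntax.cong d e f)    ρ = ◁▷-cong (⊢-sound ⊨E d ρ) (⊢-sound ⊨E e ρ) (⊢-sound ⊨E f ρ)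
  ⊢-sound ⊨E (Syntax.inst {t} {t′} σ d) ρ =
    ≈.trans (eval-[] ρ σ t) (≈.trans (⊢-sound ⊨E d (eval 𝔸 ρ ∘ σ)) (≈.sym (eval-[] ρ σ t′)))

-- Consequences of CPmem

module Derivations {A : Set} where

  infix 4 _≋_
  _≋_ : OpenTerm A → OpenTerm A → Set
  _≋_ = CPmem ⊢_≈_

  ≋-setoid : Setoid _ _
  ≋-setoid = record
    { _≈_ = _≋_
    ; isEquivalence = record { refl = Syntax.refl ; sym = Syntax.sym ; trans = Syntax.trans }
    }

  open Setoid ≋-setoid using () renaming (refl to ≋-refl; sym to ≋-sym; trans to ≋-trans)
  open SetoidReasoning ≋-setoid

  private
    assign : (x y z u v w : OpenTerm A) → ℕ → OpenTerm A
    assign x y z u v w 0 = x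
    assign x y z u v w 1 = y
    assign x y z u v w 2 = z
    assign x y z u v w 3 = u
    assign x y z u v w 4 = v
    assign x y z u v w _ = w

  congˡ : ∀ {x x′ y z} → x ≋ x′ → x ◁ y ▷ z ≋ x′ ◁ y ▷ z
  congˡ d = Syntax.cong d ≋-refl ≋-refl

  congʳ : ∀ {x y z z′} → z ≋ z′ → x ◁ y ▷ z ≋ x ◁ y ▷ z′
  congʳ d = Syntax.cong ≋-refl ≋-refl d

  ◁T▷ : ∀ x y → x ◁ T ▷ y ≋ x
  ◁T▷ x y = Syntax.inst (assign x y T T T T) (Syntax.axiom (CPmem.cp CP.CP1))

  ◁F▷ : ∀ x y → x ◁ F ▷ y ≋ y
  ◁F▷ x y = Syntax.inst (assign x y T T T T) (Syntax.axiom (CPmem.cp CP.CP2))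

  T◁▷F : ∀ x → T ◁ x ▷ F ≋ x
  T◁▷F x = Syntax.inst (assign x T T T T T) (Syntax.axiom (CPmem.cp CP.CP3))

  ◁▷-assoc : ∀ x y z u v → x ◁ (y ◁ z ▷ u) ▷ v ≋ (x ◁ y ▷ v) ◁ z ▷ (x ◁ u ▷ v)
  ◁▷-assoc x y z u v = Syntax.inst (assign x y z u v T) (Syntax.axiom (CPmem.cp CP.CP4))

  ◁▷-mem : ∀ x y z u v w → x ◁ y ▷ (z ◁ u ▷ (v ◁ y ▷ w)) ≋ x ◁ y ▷ (z ◁ u ▷ w)
  ◁▷-mem x y z u v w = Syntax.inst (assign x y z u v w) (Syntax.axiom CPmem.mem)

  neg : OpenTerm A → OpenTerm A
  neg x = F ◁ x ▷ T

  infixr 7 _∨_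
  _∨_ : OpenTerm A → OpenTerm A → OpenTerm A
  x ∨ y = T ◁ x ▷ y

  ◁neg▷ : ∀ x y z → x ◁ neg y ▷ z ≋ z ◁ y ▷ x
  ◁neg▷ x y z = ≋-trans (◁▷-assoc x F y T z) (Syntax.cong (◁F▷ x z) ≋-refl (◁T▷ x z))

  ◁∨▷ : ∀ x y z u → x ◁ y ∨ z ▷ u ≋ x ◁ y ▷ (x ◁ z ▷ u)
  ◁∨▷ x y z u = ≋-trans (◁▷-assoc x T y z u) (congˡ (◁T▷ x u))

  contractʳ : ∀ x y v w → x ◁ y ▷ (v ◁ y ▷ w) ≋ x ◁ y ▷ w
  contractʳ x y v w = begin
    x ◁ y ▷ (v ◁ y ▷ w)           ≈⟨ congʳ (◁F▷ F _) ⟨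
    x ◁ y ▷ (F ◁ F ▷ (v ◁ y ▷ w)) ≈⟨ ◁▷-mem x y F F v w ⟩
    x ◁ y ▷ (F ◁ F ▷ w)           ≈⟨ congʳ (◁F▷ F w) ⟩
    x ◁ y ▷ w                     ∎

  -- Negating the test exchanges the branches, which turns this into `contractʳ`.
  contractˡ : ∀ x y v w → (v ◁ y ▷ w) ◁ y ▷ x ≋ v ◁ y ▷ x
  contractˡ x y v w = begin
    (v ◁ y ▷ w) ◁ y ▷ x         ≈⟨ ◁neg▷ x y _ ⟨
    x ◁ neg y ▷ (v ◁ y ▷ w)     ≈⟨ congʳ (◁neg▷ w y v) ⟨
    x ◁ neg y ▷ (w ◁ neg y ▷ v) ≈⟨ contractʳ x (neg y) w v ⟩
    x ◁ neg y ▷ v               ≈⟨ ◁neg▷ x y v ⟩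
    v ◁ y ▷ x                   ∎

  ◁▷-memˡ : ∀ x y z u v w → x ◁ y ▷ ((v ◁ y ▷ w) ◁ u ▷ z) ≋ x ◁ y ▷ (w ◁ u ▷ z)
  ◁▷-memˡ x y z u v w = begin
    x ◁ y ▷ ((v ◁ y ▷ w) ◁ u ▷ z)     ≈⟨ congʳ (◁neg▷ z u _) ⟨
    x ◁ y ▷ (z ◁ neg u ▷ (v ◁ y ▷ w)) ≈⟨ ◁▷-mem x y z (neg u) v w ⟩
    x ◁ y ▷ (z ◁ neg u ▷ w)           ≈⟨ congʳ (◁neg▷ z u w) ⟩
    x ◁ y ▷ (w ◁ u ▷ z)               ∎

  -- Collapses two nested tests into one, so that CPmem applies at any depth.
  fuse : ∀ x y z u v → (x ◁ y ▷ z) ◁ y ∨ u ▷ v ≋ x ◁ y ▷ (z ◁ u ▷ v)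
  fuse x y z u v = begin
    (x ◁ y ▷ z) ◁ y ∨ u ▷ v                   ≈⟨ ◁∨▷ _ y u v ⟩
    (x ◁ y ▷ z) ◁ y ▷ ((x ◁ y ▷ z) ◁ u ▷ v)   ≈⟨ contractˡ _ y x z ⟩
    x ◁ y ▷ ((x ◁ y ▷ z) ◁ u ▷ v)             ≈⟨ ◁▷-memˡ x y v u x z ⟩
    x ◁ y ▷ (z ◁ u ▷ v)                       ∎

module Memory {A : Set} (_≟_ : DecidableEquality A) where

  open Derivations {A}
  open Setoid ≋-setoid using () renaming (refl to ≋-refl; sym to ≋-sym; trans to ≋-trans)

  -- Histories of recorded replies

  History : Set
  History = List (A × Bool)

  lookup : A → History → Maybe Bool
  lookup a []            = nothing
  lookup a ((a′ , b) ∷ Γ) with a ≟ a′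
  ... | yes _ = just b
  ... | no  _ = lookup a Γ

  infix 4 _⊑_
  _⊑_ : History → History → Set
  Γ ⊑ Δ = ∀ a {b} → lookup a Γ ≡ just b → lookup a Δ ≡ just b

  lookup-here : ∀ a b Γ → lookup a ((a , b) ∷ Γ) ≡ just b
  lookup-here a b Γ with a ≟ a
  ... | yes _  = refl
  ... | no a≢a = contradiction refl a≢a

  ⊑-fresh : ∀ {a Γ} b → lookup a Γ ≡ nothing → Γ ⊑ (a , b) ∷ Γ
  ⊑-fresh {a} b fresh a′ known with a′ ≟ a
  ... | no _     = known
  ... | yes refl with () ← trans (sym fresh) known

  -- Evaluation in a state

  State : Set
  State = (ℕ → Bool) × History

  history : Bool × State → History
  history (_ , _ , Γ) = Γ

  ask : A → Maybe Bool → State → Bool × State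
  ask a (just b) s       = b , s
  ask a nothing  (f , Γ) = f 0 , f ∘ suc , (a , f 0) ∷ Γ

  branch : (g h : State → Bool × State) → Bool × State → Bool × State
  branch g h (true  , s) = g s
  branch g h (false , s) = h s

  run : ClosedTerm A → State → Bool × State
  run T           s = true , s
  run F           s = false , s
  run (atom a)    s = ask a (lookup a (proj₂ s)) s
  run (x ◁ y ▷ z) s = branch (run x) (run z) (run y s)

  run-⊑ : ∀ t s → proj₂ s ⊑ history (run t s)
  run-⊑ T           s a′ known = known
  run-⊑ F           s a′ known = known
  run-⊑ (atom a)    s a′ known with lookup a (proj₂ s) in eq
  ... | just _  = known
  ... | nothing = ⊑-fresh _ eq a′ known
  run-⊑ (x ◁ y ▷ z) s a′ known with run y s | run-⊑ y s a′ known
  ... | true  , s′ | known′ = run-⊑ x s′ a′ known′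
  ... | false , s′ | known′ = run-⊑ z s′ a′ known′

  -- All replies used by `t` are in its final history. From a state that remembers them, `t` never
  -- reaches the oracle, so it repeats its reply and changes nothing.
  replay : ∀ t s {s′} → history (run t s) ⊑ proj₂ s′ → run t s′ ≡ (proj₁ (run t s) , s′)
  replay T           s ext = refl
  replay F           s ext = refl
  replay (atom a)    s ext with lookup a (proj₂ s) in eq
  ... | just b  rewrite ext a eq = refl
  ... | nothing rewrite ext a (lookup-here a _ (proj₂ s)) = refl
  replay (x ◁ y ▷ z) s {s′} ext with run y s | replay y s {s′}
  ... | true  , s₁ | replay-y
    rewrite replay-y (λ a → ext a ∘ run-⊑ x s₁ a) = replay x s₁ ext
  ... | false , s₁ | replay-y
    rewrite replay-y (λ a → ext a ∘ run-⊑ z s₁ a) = replay z s₁ ext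

  -- The algebra of closed terms up to equal runs

  infix 4 _≈_
  _≈_ : ClosedTerm A → ClosedTerm A → Set
  x ≈ y = ∀ s → run x s ≡ run y s

  run-cong : ∀ {x x′ y y′ z z′} → x ≈ x′ → y ≈ y′ → z ≈ z′ → x ◁ y ▷ z ≈ x′ ◁ y′ ▷ z′
  run-cong {y′ = y′} x≈x′ y≈y′ z≈z′ s rewrite y≈y′ s with run y′ s
  ... | true  , s′ = x≈x′ s′
  ... | false , s′ = z≈z′ s′

  -- With a syntactic carrier and semantic equality, a closed term evaluates to itself.
  𝔸mem : CEAlgebra A
  𝔸mem = record
    { Carrier       = ClosedTerm A
    ; _≈_           = _≈_
    ; isEquivalence = record
        { refl  = λ _ → refl
        ; sym   = λ p s → sym (p s)
        ; trans = λ p q s → trans (p s) (q s)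
        }
    ; T = T ; F = F ; atom = atom ; _◁_▷_ = _◁_▷_
    ; ◁▷-cong = λ {x} {x′} {y} {y′} {z} {z′} → run-cong {x} {x′} {y} {y′} {z} {z′}
    }

  𝔸mem⊨CP : _⊨_ 𝔸mem CP
  𝔸mem⊨CP CP.CP1 ρ s = refl
  𝔸mem⊨CP CP.CP2 ρ s = refl
  𝔸mem⊨CP CP.CP3 ρ s with run (ρ 0) s
  ... | true  , _ = refl
  ... | false , _ = refl
  𝔸mem⊨CP CP.CP4 ρ s with run (ρ 2) s
  ... | true  , _ = refl
  ... | false , _ = refl

  run-mem : ∀ x y z u v w → x ◁ y ▷ (z ◁ u ▷ (v ◁ y ▷ w)) ≈ x ◁ y ▷ (z ◁ u ▷ w)
  run-mem x y z u v w s with run y s | replay y s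
  ... | true  , _  | _ = refl
  ... | false , s₁ | replay-y with run u s₁ | run-⊑ u s₁
  ...   | true  , _  | _   = refl
  -- `s₂` remembers all that `y` left in `s₁`, so the second `y` again replies `false` and preserves
  -- `s₂`.
  ...   | false , s₂ | ext rewrite replay-y {s₂} ext = refl

  𝔸mem⊨CPmem : _⊨_ 𝔸mem CPmem
  𝔸mem⊨CPmem (CPmem.cp e) ρ = 𝔸mem⊨CP e ρ
  𝔸mem⊨CPmem CPmem.mem    ρ = run-mem (ρ 0) (ρ 1) (ρ 2) (ρ 3) (ρ 4) (ρ 5)

  eval-ι : ∀ ρ t → eval 𝔸mem ρ (ι t) ≡ t
  eval-ι ρ T           = refl
  eval-ι ρ F           = refl
  eval-ι ρ (atom a)    = refl
  eval-ι ρ (x ◁ y ▷ z) = cong₂ _$_ (cong₂ _◁_▷_ (eval-ι ρ x) (eval-ι ρ y)) (eval-ι ρ z)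

  ⊨⇒≈ : ∀ t t′ → _⊨_≈_ 𝔸mem (ι t) (ι t′) → t ≈ t′
  ⊨⇒≈ t t′ valid = subst₂ _≈_ (eval-ι ρ t) (eval-ι ρ t′) (valid ρ)
    where
    ρ : ℕ → ClosedTerm A
    ρ _ = T

  ⊢⇒≈ : ∀ t t′ → CPmem ⊢ ι t ≈ ι t′ → t ≈ t′
  ⊢⇒≈ t t′ d = ⊨⇒≈ t t′ (⊢-sound 𝔸mem 𝔸mem⊨CPmem d)

  -- Normal forms

  data Tree : Set where
    leaf : Bool → Tree
    node : A → Tree → Tree → Tree

  Continuation : Set
  Continuation = History → Bool → Tree

  query : A → Maybe Bool → History → Continuation → Tree
  query a (just b) Γ k = k Γ b
  query a nothing  Γ k = node a (k ((a , true) ∷ Γ) true) (k ((a , false) ∷ Γ) false)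

  -- Continuation passing carries the history along each path, so a later test can see which atoms
  -- the path has already queried.
  normalise : ClosedTerm A → History → Continuation → Tree
  normalise T           Γ k = k Γ true
  normalise F           Γ k = k Γ false
  normalise (atom a)    Γ k = query a (lookup a Γ) Γ k
  normalise (x ◁ y ▷ z) Γ k =
    normalise y Γ (λ Δ b → if b then normalise x Δ k else normalise z Δ k)

  nf : ClosedTerm A → Tree
  nf t = normalise t [] (λ _ → leaf)

  -- Passing `nothing` ignores the memory: every node consumes an oracle bit, so the oracle can
  -- reach every path.
  walk : Tree → State → Bool × State
  walk (leaf b)     s = b , s
  walk (node a P Q) s = branch (walk P) (walk Q) (ask a nothing s)

  -- `normalise` creates a node exactly where the lookup fails, which is where `run` turns to the
  -- oracle.
  walk-normalise : ∀ t f Γ k → let (b , f′ , Δ) = run t (f , Γ) in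
                   walk (normalise t Γ k) (f , Γ) ≡ walk (k Δ b) (f′ , Δ)
  walk-normalise T           f Γ k = refl
  walk-normalise F           f Γ k = refl
  walk-normalise (atom a)    f Γ k with lookup a Γ
  ... | just _  = refl
  ... | nothing with f 0
  ...   | true  = refl
  ...   | false = refl
  walk-normalise (x ◁ y ▷ z) f Γ k
    with run y (f , Γ) | walk-normalise y f Γ (λ Δ b → if b then normalise x Δ k else normalise z Δ k)
  ... | true  , f′ , Δ | eq = trans eq (walk-normalise x f′ Δ k)
  ... | false , f′ , Δ | eq = trans eq (walk-normalise z f′ Δ k)

  walk-nf : ∀ t f → walk (nf t) (f , []) ≡ run t (f , [])
  walk-nf t f = walk-normalise t f [] (λ _ → leaf)

  -- Recovering a tree from its walks

  walk-++ : ∀ P f Γ → ∃[ Δ ] history (walk P (f , Γ)) ≡ Δ ++ Γ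
  -- Entries are added at the front, so the root query is the last entry of the new segment and can
  -- be read off the final history.
  walk-node-++ : ∀ a P Q f Γ →
                 ∃[ Δ ] history (walk (node a P Q) (f , Γ)) ≡ (Δ ∷ʳ (a , f 0)) ++ Γ

  walk-++ (leaf b)     f Γ = [] , refl
  walk-++ (node a P Q) f Γ = _ , proj₂ (walk-node-++ a P Q f Γ)

  walk-node-++ a P Q f Γ with f 0
  ... | true  = let Δ , eq = walk-++ P (f ∘ suc) ((a , true) ∷ Γ) in
                Δ , trans eq (sym (∷ʳ-++ Δ _ Γ))
  ... | false = let Δ , eq = walk-++ Q (f ∘ suc) ((a , false) ∷ Γ) in
                Δ , trans eq (sym (∷ʳ-++ Δ _ Γ))

  walk-leaf≢node : ∀ b a P Q s → walk (leaf b) s ≢ walk (node a P Q) s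
  walk-leaf≢node b a P Q (f , Γ) eq
    with walk-node-++ a P Q f Γ
  ... | Δ , extended with ++-cancelʳ Γ [] (Δ ∷ʳ (a , f 0)) (trans (cong history eq) extended)
  -- Splitting on `Δ` lets `∷ʳ` compute to a non-empty list, which cannot equal `[]`.
  walk-leaf≢node b a P Q (f , Γ) eq | []    , _ | ()
  walk-leaf≢node b a P Q (f , Γ) eq | _ ∷ _ , _ | ()

  walk-root : ∀ a P Q a′ P′ Q′ s → walk (node a P Q) s ≡ walk (node a′ P′ Q′) s → a ≡ a′
  walk-root a P Q a′ P′ Q′ (f , Γ) eq =
    let Δ  , extended  = walk-node-++ a P Q f Γ
        Δ′ , extended′ = walk-node-++ a′ P′ Q′ f Γ
    in cong proj₁ (∷ʳ-injectiveʳ Δ Δ′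
         (++-cancelʳ Γ _ _ (trans (sym extended) (trans (cong history eq) extended′))))

  infixr 5 _∷ˢ_
  _∷ˢ_ : Bool → (ℕ → Bool) → ℕ → Bool
  (b ∷ˢ f) zero    = b
  (b ∷ˢ f) (suc n) = f n

  walk-injective : ∀ P Q Γ → (∀ f → walk P (f , Γ) ≡ walk Q (f , Γ)) → P ≡ Q
  walk-injective (leaf b) (leaf b′) Γ same = cong (leaf ∘ proj₁) (same (λ _ → true))
  walk-injective (leaf b) (node a P Q) Γ same =
    contradiction (same (λ _ → true)) (walk-leaf≢node b a P Q _)
  walk-injective (node a P Q) (leaf b) Γ same =
    contradiction (sym (same (λ _ → true))) (walk-leaf≢node b a P Q _)
  walk-injective (node a P Q) (node a′ P′ Q′) Γ same
    with refl ← walk-root a P Q a′ P′ Q′ ((λ _ → true) , Γ) (same (λ _ → true)) =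
    cong₂ (node a)
      -- The bit put in front of `f` answers the root and steers both walks into the same subtree.
      (walk-injective P P′ _ (λ f → same (true ∷ˢ f)))
      (walk-injective Q Q′ _ (λ f → same (false ∷ˢ f)))

  nf-cong : ∀ t t′ → t ≈ t′ → nf t ≡ nf t′
  nf-cong t t′ t≈t′ = walk-injective (nf t) (nf t′) []
    (λ f → trans (walk-nf t f) (trans (t≈t′ _) (sym (walk-nf t′ f))))

  -- Derivability of normal forms

  reflect : Bool → ∀ {V} → Term A V
  reflect true  = T
  reflect false = F

  ⌜_⌝ : Tree → OpenTerm A
  ⌜ leaf b ⌝     = reflect b
  ⌜ node a P Q ⌝ = ⌜ P ⌝ ◁ atom a ▷ ⌜ Q ⌝

  opposite : A × Bool → OpenTerm A
  opposite (a , true)  = neg (atom a)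
  opposite (a , false) = atom a

  -- Fails exactly on the evaluations that produce the given history.
  guard : History → OpenTerm A
  guard []      = F
  guard (p ∷ Γ) = guard Γ ∨ opposite p

  infix 4 _≋⟨_⟩_
  -- Provable equality under the assumption `Γ`. CPmem simplifies negative branches, so the
  -- assumption is a failed guard, with any term in the other branch.
  _≋⟨_⟩_ : OpenTerm A → History → OpenTerm A → Set
  x ≋⟨ Γ ⟩ y = ∀ z → z ◁ guard Γ ▷ x ≋ z ◁ guard Γ ▷ y

  open SetoidReasoning ≋-setoid

  -- Moves the branch selected by `b` into the negative position, where CPmem can discard the other
  -- one.
  ◁opposite▷ : ∀ a b x y →
    x ◁ atom a ▷ y ≋ (if b then y else x) ◁ opposite (a , b) ▷ (if b then x else y)
  ◁opposite▷ a true  x y = ≋-sym (◁neg▷ y (atom a) x)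
  ◁opposite▷ a false x y = ≋-refl

  -- The intermediate test u strengthens the induction hypothesis: it absorbs
  -- the literals recorded after a.
  recall-under : ∀ a b Γ → lookup a Γ ≡ just b → ∀ z z′ u x y →
    z ◁ guard Γ ▷ (z′ ◁ u ▷ (x ◁ atom a ▷ y)) ≋ z ◁ guard Γ ▷ (z′ ◁ u ▷ (if b then x else y))
  recall-under a b ((a′ , b′) ∷ Γ) known z z′ u x y with a ≟ a′
  recall-under a b ((a  , b)  ∷ Γ) refl z z′ u x y | yes refl = begin
    z ◁ guard Γ ∨ l ▷ (z′ ◁ u ▷ (x ◁ atom a ▷ y))
      ≈⟨ ◁∨▷ z (guard Γ) l _ ⟩
    z ◁ guard Γ ▷ (z ◁ l ▷ (z′ ◁ u ▷ (x ◁ atom a ▷ y)))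
      ≈⟨ congʳ (congʳ (congʳ (◁opposite▷ a b x y))) ⟩
    z ◁ guard Γ ▷ (z ◁ l ▷ (z′ ◁ u ▷ (_ ◁ l ▷ (if b then x else y))))
      ≈⟨ congʳ (◁▷-mem z l z′ u _ _) ⟩
    z ◁ guard Γ ▷ (z ◁ l ▷ (z′ ◁ u ▷ (if b then x else y)))
      ≈⟨ ◁∨▷ z (guard Γ) l _ ⟨
    z ◁ guard Γ ∨ l ▷ (z′ ◁ u ▷ (if b then x else y)) ∎
    where l = opposite (a , b)
  recall-under a b ((a′ , b′) ∷ Γ) known z z′ u x y | no _ = begin
    z ◁ guard Γ ∨ l ▷ (z′ ◁ u ▷ (x ◁ atom a ▷ y))
      ≈⟨ ◁∨▷ z (guard Γ) l _ ⟩
    z ◁ guard Γ ▷ (z ◁ l ▷ (z′ ◁ u ▷ (x ◁ atom a ▷ y)))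
      ≈⟨ congʳ (fuse z l z′ u _) ⟨
    z ◁ guard Γ ▷ ((z ◁ l ▷ z′) ◁ l ∨ u ▷ (x ◁ atom a ▷ y))
      ≈⟨ recall-under a b Γ known z (z ◁ l ▷ z′) (l ∨ u) x y ⟩
    z ◁ guard Γ ▷ ((z ◁ l ▷ z′) ◁ l ∨ u ▷ (if b then x else y))
      ≈⟨ congʳ (fuse z l z′ u _) ⟩
    z ◁ guard Γ ▷ (z ◁ l ▷ (z′ ◁ u ▷ (if b then x else y)))
      ≈⟨ ◁∨▷ z (guard Γ) l _ ⟨
    z ◁ guard Γ ∨ l ▷ (z′ ◁ u ▷ (if b then x else y)) ∎
    where l = opposite (a′ , b′)

  recall : ∀ {a b Γ} → lookup a Γ ≡ just b → ∀ x y → x ◁ atom a ▷ y ≋⟨ Γ ⟩ (if b then x else y)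
  recall {a} {b} {Γ} known x y z = begin
    -- A test on `F` serves as the trivial intermediate test.
    z ◁ guard Γ ▷ (x ◁ atom a ▷ y)             ≈⟨ congʳ (◁F▷ F _) ⟨
    z ◁ guard Γ ▷ (F ◁ F ▷ (x ◁ atom a ▷ y))   ≈⟨ recall-under a b Γ known z F F x y ⟩
    z ◁ guard Γ ▷ (F ◁ F ▷ (if b then x else y)) ≈⟨ congʳ (◁F▷ F _) ⟩
    z ◁ guard Γ ▷ (if b then x else y)         ∎

  -- The hypothesis only speaks about one choice w for the positive branch of
  -- both tests; contractʳ frees the outer occurrence.
  extend : ∀ Γ l w {x x′} → w ◁ guard Γ ∨ l ▷ x ≋ w ◁ guard Γ ∨ l ▷ x′ →
           w ◁ l ▷ x ≋⟨ Γ ⟩ w ◁ l ▷ x′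
  extend Γ l w {x} {x′} eq z = begin
    z ◁ guard Γ ▷ (w ◁ l ▷ x)                     ≈⟨ contractʳ z (guard Γ) w _ ⟨
    z ◁ guard Γ ▷ (w ◁ guard Γ ▷ (w ◁ l ▷ x))     ≈⟨ congʳ (◁∨▷ w (guard Γ) l x) ⟨
    z ◁ guard Γ ▷ (w ◁ guard Γ ∨ l ▷ x)           ≈⟨ congʳ eq ⟩
    z ◁ guard Γ ▷ (w ◁ guard Γ ∨ l ▷ x′)          ≈⟨ congʳ (◁∨▷ w (guard Γ) l x′) ⟩
    z ◁ guard Γ ▷ (w ◁ guard Γ ▷ (w ◁ l ▷ x′))    ≈⟨ contractʳ z (guard Γ) w _ ⟩
    z ◁ guard Γ ▷ (w ◁ l ▷ x′)                    ∎

  ◁atom▷-cong : ∀ {a Γ x x′ y y′} → x ≋⟨ (a , true) ∷ Γ ⟩ x′ → y ≋⟨ (a , false) ∷ Γ ⟩ y′ →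
                x ◁ atom a ▷ y ≋⟨ Γ ⟩ x′ ◁ atom a ▷ y′
  ◁atom▷-cong {a} {Γ} {x} {x′} {y} {y′} x≋x′ y≋y′ z = begin
    z ◁ guard Γ ▷ (x ◁ atom a ▷ y)        ≈⟨ extend Γ (atom a) x (y≋y′ x) z ⟩
    -- The positive branch is replaced after a negation has made it the negative one.
    z ◁ guard Γ ▷ (x ◁ atom a ▷ y′)       ≈⟨ congʳ (◁neg▷ y′ (atom a) x) ⟨
    z ◁ guard Γ ▷ (y′ ◁ neg (atom a) ▷ x) ≈⟨ extend Γ (neg (atom a)) y′ (x≋x′ y′) z ⟩
    z ◁ guard Γ ▷ (y′ ◁ neg (atom a) ▷ x′) ≈⟨ congʳ (◁neg▷ y′ (atom a) x′) ⟩
    z ◁ guard Γ ▷ (x′ ◁ atom a ▷ y′)      ∎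

  -- With `ι t` in test position, CP4 unfolds a conditional just as `normalise` nests continuations.
  -- The hypotheses range over all `Δ` because the test may extend the history.
  normalise-≋ : ∀ t Γ k {x y} →
    (∀ Δ → x ≋⟨ Δ ⟩ ⌜ k Δ true ⌝) → (∀ Δ → y ≋⟨ Δ ⟩ ⌜ k Δ false ⌝) →
    x ◁ ι t ▷ y ≋⟨ Γ ⟩ ⌜ normalise t Γ k ⌝
  normalise-≋ T        Γ k x≋ y≋ z = ≋-trans (congʳ (◁T▷ _ _)) (x≋ Γ z)
  normalise-≋ F        Γ k x≋ y≋ z = ≋-trans (congʳ (◁F▷ _ _)) (y≋ Γ z)
  normalise-≋ (atom a) Γ k x≋ y≋ z with lookup a Γ in eq
  ... | just true  = ≋-trans (recall eq _ _ z) (x≋ Γ z)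
  ... | just false = ≋-trans (recall eq _ _ z) (y≋ Γ z)
  ... | nothing    = ◁atom▷-cong (x≋ _) (y≋ _) z
  normalise-≋ (t ◁ u ▷ v) Γ k x≋ y≋ z = ≋-trans
    (congʳ (◁▷-assoc _ (ι t) (ι u) (ι v) _))
    (normalise-≋ u Γ _ (λ Δ → normalise-≋ t Δ k x≋ y≋) (λ Δ → normalise-≋ v Δ k x≋ y≋) z)

  nf-≋ : ∀ t → ι t ≋ ⌜ nf t ⌝
  nf-≋ t = begin
    ι t                   ≈⟨ T◁▷F (ι t) ⟨
    T ◁ ι t ▷ F           ≈⟨ ◁F▷ T _ ⟨
    -- `F` is `guard []`, the guard that assumes nothing.
    T ◁ F ▷ (T ◁ ι t ▷ F) ≈⟨ normalise-≋ t [] (λ _ → leaf) (λ _ _ → ≋-refl) (λ _ _ → ≋-refl) T ⟩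
    T ◁ F ▷ ⌜ nf t ⌝      ≈⟨ ◁F▷ T _ ⟩
    ⌜ nf t ⌝              ∎

  ≈⇒⊢ : ∀ t t′ → t ≈ t′ → CPmem ⊢ ι t ≈ ι t′
  ≈⇒⊢ t t′ t≈t′ = ≋-trans (nf-≋ t)
    (subst (λ P → ⌜ P ⌝ ≋ ι t′) (sym (nf-cong t t′ t≈t′)) (≋-sym (nf-≋ t′)))

  ⊢⇔𝔸mem⊨ : ∀ t t′ → (CPmem ⊢ ι t ≈ ι t′) ⇔ (_⊨_≈_ 𝔸mem (ι t) (ι t′))
  ⊢⇔𝔸mem⊨ t t′ = mk⇔ (⊢-sound 𝔸mem 𝔸mem⊨CPmem) (≈⇒⊢ t t′ ∘ ⊨⇒≈ t t′)

  -- The stateful proposition algebra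

  infix 7 _!_
  _!_ : ClosedTerm A → State → ClosedTerm A
  x ! s = reflect (proj₁ (run x s))

  infixr 7 _•_
  _•_ : ClosedTerm A → State → State
  x • s = proj₂ (run x s)

  initial : State
  initial = (λ _ → true) , []

  -- The state conditional must tell `T`, `F` and all other elements apart up to `≈`. The normal
  -- form decides this: leaves are the constants.
  select : Tree → State → State → State
  select (leaf true)  s s′ = s
  select (leaf false) s s′ = s′
  select (node _ _ _) s s′ = initial

  -- A leaf makes `x` provably equal to a constant, and soundness carries this over to `≈`.
  nf-leaf⇒≈ : ∀ b x → nf x ≡ leaf b → x ≈ reflect b
  nf-leaf⇒≈ true  x eq = ⊢⇒≈ x T (subst (λ P → ι x ≋ ⌜ P ⌝) eq (nf-≋ x))
  nf-leaf⇒≈ false x eq = ⊢⇒≈ x F (subst (λ P → ι x ≋ ⌜ P ⌝) eq (nf-≋ x))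

  select-nonconstant : ∀ x s s′ → ¬ x ≈ T → ¬ x ≈ F → select (nf x) s s′ ≡ initial
  select-nonconstant x s s′ x≉T x≉F with nf x in eq
  ... | leaf true  = contradiction (nf-leaf⇒≈ true x eq) x≉T
  ... | leaf false = contradiction (nf-leaf⇒≈ false x eq) x≉F
  ... | node _ _ _ = refl

  reflect-injective : ∀ b b′ → reflect b ≈ reflect b′ → b ≡ b′
  reflect-injective true  true  _ = refl
  reflect-injective false false _ = refl
  reflect-injective true  false T≈F with () ← T≈F initial
  reflect-injective false true  F≈T with () ← F≈T initial

  !-branch : ∀ x y z s → (x ◁ y ▷ z) ! s ≈ (x ! (y • s)) ◁ (y ! s) ▷ (z ! (y • s))
  !-branch x y z s _ with run y s
  ... | true  , _ = refl
  ... | false , _ = refl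

  •-branch : ∀ x y z s →
             (x ◁ y ▷ z) • s ≡ select (nf (y ! s)) (x • (y • s)) (z • (y • s))
  •-branch x y z s with run y s
  ... | true  , _ = refl
  ... | false , _ = refl

  !-two-valued : ∀ x s → x ! s ≈ T ⊎ x ! s ≈ F
  !-two-valued x s with proj₁ (run x s)
  ... | true  = inj₁ (λ _ → refl)
  ... | false = inj₂ (λ _ → refl)

  SPAmem : StatefulPropositionAlgebra A
  SPAmem = record
    { reduct         = 𝔸mem
    ; S              = State
    ; _≈ˢ_           = _≡_
    ; isEquivalenceˢ = isEquivalence
    ; c              = initial
    ; _◁ˢ_▷_         = λ s x → select (nf x) s
    ; _•_            = _•_
    ; _!_            = _!_
    ; ◁ˢ▷-cong       = λ { {x = x} {y} refl x≈y refl → cong (λ P → select P _ _) (nf-cong x y x≈y) }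
    ; •-cong         = λ { x≈y refl → cong proj₂ (x≈y _) }
    ; !-cong         = λ { x≈y refl _ → cong (λ r → run (reflect (proj₁ r)) _) (x≈y _) }
    ; cp             = 𝔸mem⊨CP
    ; TS1            = λ _ _ → refl
    ; TS2            = λ _ _ → refl
    ; TS3            = select-nonconstant
    ; SPA1           = λ _ _ → refl
    ; SPA2           = λ _ _ → refl
    ; SPA3           = !-branch
    ; SPA4           = λ _ → refl
    ; SPA5           = λ _ → refl
    ; SPA6           = •-branch
    ; SPA7           = !-two-valued
    -- A run is a pair of reply and final state, and `reflect` loses no reply, so the two agreements
    -- amount to `≈`.
    ; SPA8           = λ x y same-reply same-state s →
        cong₂ _,_ (reflect-injective _ _ (same-reply s)) (same-state s)
    }

theorem7 : (A : Set) → Denumerable A → ∣ A ∣>1 →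
    Σ[ 𝔸 ∈ CEAlgebra A ] (IsHoareMcCarthyAlgebra 𝔸 ×
    (∀ (t t′ : ClosedTerm A) → (CPmem ⊢ ι t ≈ ι t′) ⇔ (𝔸 ⊨ ι t ≈ ι t′)))
theorem7 A denumerable _ = 𝔸mem , (SPAmem , refl) , ⊢⇔𝔸mem⊨
  where open Memory (denumerable⇒≟ denumerable)
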